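{- Every correct parallel algorithm for the length-$N$ DFT satisfying the owner-computes and no-replication assumptions stated in the context requires at least one global redistribution round: $R\ge1$.
   Context: The length-$N$ DFT is $y=\Omega_N x$ with $(\Omega_N)_{k,j}=\exp(-2\pi\imath kj/N)$, $x\in\mathbb C^N$ arbitrary. There are $p\ge2$ processors. With $N=N_1N_2$, $p\mid N_1$, $p\mid N_2$, input item $x[j_1N_2+j_2]$ ($0\le j_1<N_1$, $0\le j_2<N_2$) is initially owned by processor $\lfloor j_2p/N_2\rfloor$ only. Owner-computes / no-replication model: input values are initially unreplicated (each is stored on exactly one processor), no processor initially owns the entire input, and a processor obtains a value owned by another processor only through an explicit BSP communication superstep. A global redistribution round consists of local packing, one BSP $h$-relation (a communication superstep in which every processor sends and receives at most $h$ remote items), and local unpacking; $R$ is the number of such rounds. Every output coefficient is returned by some processor, and correctness means that the returned coefficients equal those of $\Omega_Nx$ for every input $x$. -}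

module Defs where

open import Algebra.Bundles using (CommutativeRing)
open import Data.Integer.Base as ℤ using (+_; 1ℤ)
import Data.Integer.Properties as ℤₚ
open import Data.Nat.Base as ℕ using (ℕ; zero; suc; NonZero; NonTrivial)
import Data.Nat.Properties as ℕₚ
open import Data.Nat.Divisibility using (_∣_; ∣⇒≤)
open import Data.Product.Base using (∃; ∃-syntax; ∃₂; _×_; _,_; proj₁; proj₂)
open import Data.Rational.Base as ℚ using (ℚ; 0ℚ; 1ℚ; ½; ∣_∣; _/_; toℚᵘ)
import Data.Rational.Properties as ℚₚ
open import Data.Rational.Solver using (module +-*-Solver)
import Data.Rational.Unnormalised.Base as ℚᵘ
import Data.Rational.Unnormalised.Properties as ℚᵘₚ
open import Data.Fin.Base using (Fin; zero; toℕ; fromℕ; fromℕ<; remainder; combine)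
open import Data.Fin.Properties using (_≟_; nonZeroIndex; toℕ<n; toℕ-fromℕ; toℕ-fromℕ<; remQuot-combine)
open import Data.List.Base using (List; []; _∷_; length; map; filter; allFin)
import Data.List.Relation.Binary.Pointwise as List
open import Data.Maybe.Base using (just)
import Data.Maybe.Relation.Binary.Pointwise as Maybe
import Data.Nat.ListAction as ListAction
open import Data.Nat.DivMod using (m<n*o⇒m/o<n; m≥n⇒m/n>0; 0/n≡0)
open import Data.Product.Relation.Binary.Pointwise.NonDependent using (_×ₛ_)
open import Data.Unit.Base using (⊤)
open import Function.Bundles using (_⟶ₛ_; _⟨$⟩_)
open import Function.Indexed.Relation.Binary.Equality using (≡-setoid)
open import Level using (0ℓ; _⊔_)
open import Relation.Binary.Indexed.Heterogeneous.Construct.Trivial using (indexedSetoid)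
open import Relation.Nullary.Decidable.Core using (Dec; yes; no; ¬?)
open import Relation.Binary.Bundles using (Setoid)
open import Relation.Binary.PropositionalEquality
  using (_≡_; _≢_; refl; sym; trans; cong; cong₂; subst; subst₂; module ≡-Reasoning)

module Rationals where

  open import Data.Rational.Base using (_+_; _*_; _-_; -_; _≤_; _<_; Positive; NonNegative)
  open +-*-Solver

  ofℕ : ℕ → ℚ
  ofℕ n = + n / 1

  1/1+ : ℕ → ℚ
  1/1+ k = 1ℤ / suc k

  abstract

    ofℕ-suc : ∀ n → ofℕ (suc n) ≡ 1ℚ + ofℕ n
    ofℕ-suc n = ℚₚ.toℚᵘ-injective (begin-equality
      toℚᵘ (ofℕ (suc n))           ≃⟨ ℚₚ.toℚᵘ-fromℚᵘ (ℚᵘ.mkℚᵘ (+ suc n) 0) ⟩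
      ℚᵘ.mkℚᵘ (+ suc n) 0          ≃⟨ ℚᵘ.*≡* (cong (λ m → (1ℤ ℤ.+ m) ℤ.* 1ℤ) (sym (ℤₚ.*-identityʳ (+ n)))) ⟩
      toℚᵘ 1ℚ ℚᵘ.+ ℚᵘ.mkℚᵘ (+ n) 0 ≃⟨ ℚᵘₚ.+-congʳ (toℚᵘ 1ℚ) (ℚₚ.toℚᵘ-fromℚᵘ (ℚᵘ.mkℚᵘ (+ n) 0)) ⟨
      toℚᵘ 1ℚ ℚᵘ.+ toℚᵘ (ofℕ n)    ≃⟨ ℚₚ.toℚᵘ-homo-+ 1ℚ (ofℕ n) ⟨
      toℚᵘ (1ℚ + ofℕ n)            ∎)
      where open ℚᵘₚ.≤-Reasoning

    ofℕ*1/1+ : ∀ k → ofℕ (suc k) * 1/1+ k ≡ 1ℚ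
    ofℕ*1/1+ k = ℚₚ.toℚᵘ-injective (begin-equality
      toℚᵘ (ofℕ (suc k) * 1/1+ k)
        ≃⟨ ℚₚ.toℚᵘ-homo-* (ofℕ (suc k)) (1/1+ k) ⟩
      toℚᵘ (ofℕ (suc k)) ℚᵘ.* toℚᵘ (1/1+ k)
        ≃⟨ ℚᵘₚ.*-cong (ℚₚ.toℚᵘ-fromℚᵘ (ℚᵘ.mkℚᵘ (+ suc k) 0))
                      (ℚₚ.toℚᵘ-fromℚᵘ (ℚᵘ.mkℚᵘ 1ℤ k)) ⟩
      ℚᵘ.mkℚᵘ (+ suc k) 0 ℚᵘ.* ℚᵘ.mkℚᵘ 1ℤ k
        ≃⟨ ℚᵘ.*≡* (cong +_ (trans (ℕₚ.*-assoc (suc k) 1 1)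
                           (trans (ℕₚ.*-comm (suc k) 1) (sym (ℕₚ.*-identityˡ (1 ℕ.* suc k)))))) ⟩
      toℚᵘ 1ℚ ∎)
      where open ℚᵘₚ.≤-Reasoning

    0≤ofℕ : ∀ n → 0ℚ ≤ ofℕ n
    0≤ofℕ zero    = ℚₚ.≤-refl
    0≤ofℕ (suc n) rewrite ofℕ-suc n =
      ℚₚ.+-mono-≤ (ℚₚ.nonNegative⁻¹ 1ℚ) (0≤ofℕ n)

    ofℕ-mono : ∀ {m n} → m ℕ.≤ n → ofℕ m ≤ ofℕ n
    ofℕ-mono {n = n} ℕ.z≤n = 0≤ofℕ n
    ofℕ-mono {suc m} {suc n} (ℕ.s≤s m≤n) rewrite ofℕ-suc m | ofℕ-suc n =
      ℚₚ.+-monoʳ-≤ 1ℚ (ofℕ-mono m≤n)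

    ofℕ-+ : ∀ m n → ofℕ (m ℕ.+ n) ≡ ofℕ m + ofℕ n
    ofℕ-+ zero    n = sym (ℚₚ.+-identityˡ (ofℕ n))
    ofℕ-+ (suc m) n = begin
      ofℕ (suc (m ℕ.+ n))      ≡⟨ ofℕ-suc (m ℕ.+ n) ⟩
      1ℚ + ofℕ (m ℕ.+ n)       ≡⟨ cong (λ q → 1ℚ + q) (ofℕ-+ m n) ⟩
      1ℚ + (ofℕ m + ofℕ n)     ≡⟨ ℚₚ.+-assoc 1ℚ (ofℕ m) (ofℕ n) ⟨
      1ℚ + ofℕ m + ofℕ n       ≡⟨ cong (_+ ofℕ n) (ofℕ-suc m) ⟨
      ofℕ (suc m) + ofℕ n      ∎
      where open ≡-Reasoning

    0<1/1+ : ∀ k → 0ℚ < 1/1+ k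
    0<1/1+ k = ℚₚ.toℚᵘ-cancel-< (begin-strict
      toℚᵘ 0ℚ        <⟨ ℚᵘₚ.positive⁻¹ (ℚᵘ.mkℚᵘ 1ℤ k) ⟩
      ℚᵘ.mkℚᵘ 1ℤ k   ≃⟨ ℚₚ.toℚᵘ-fromℚᵘ (ℚᵘ.mkℚᵘ 1ℤ k) ⟨
      toℚᵘ (1/1+ k)  ∎)
      where open ℚᵘₚ.≤-Reasoning

    0≤1/1+ : ∀ k → 0ℚ ≤ 1/1+ k
    0≤1/1+ k = ℚₚ.<⇒≤ (0<1/1+ k)

    0<* : ∀ {p q} → 0ℚ < p → 0ℚ < q → 0ℚ < p * q
    0<* {p} {q} 0<p 0<q = ℚₚ.positive⁻¹ (p * q)
      {{ℚₚ.pos*pos⇒pos p {{ℚ.positive 0<p}} q {{ℚ.positive 0<q}}}}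

    *-mono-≤ : ∀ {a b c d} → 0ℚ ≤ b → 0ℚ ≤ c → a ≤ b → c ≤ d → a * c ≤ b * d
    *-mono-≤ {b = b} {c = c} 0≤b 0≤c a≤b c≤d = ℚₚ.≤-trans
      (ℚₚ.*-monoʳ-≤-nonNeg c {{ℚ.nonNegative 0≤c}} a≤b)
      (ℚₚ.*-monoˡ-≤-nonNeg b {{ℚ.nonNegative 0≤b}} c≤d)

    0≤* : ∀ {p q} → 0ℚ ≤ p → 0ℚ ≤ q → 0ℚ ≤ p * q
    0≤* {p} {q} 0≤p 0≤q = subst (_≤ p * q) (ℚₚ.*-zeroˡ q) (*-mono-≤ 0≤p 0≤q 0≤p ℚₚ.≤-refl)

    0≤+ : ∀ {p q} → 0ℚ ≤ p → 0ℚ ≤ q → 0ℚ ≤ p + q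
    0≤+ 0≤p 0≤q = ℚₚ.+-mono-≤ 0≤p 0≤q

    ofℕ*1/1+≤1 : ∀ {m k} → m ℕ.≤ suc k → ofℕ m * 1/1+ k ≤ 1ℚ
    ofℕ*1/1+≤1 {m} {k} m≤1+k = ℚₚ.≤-trans
      (*-mono-≤ (0≤ofℕ (suc k)) (0≤1/1+ k) (ofℕ-mono m≤1+k) ℚₚ.≤-refl)
      (ℚₚ.≤-reflexive (ofℕ*1/1+ k))

    half : ∀ {ε} → 0ℚ < ε → 0ℚ < ½ * ε
    half 0<ε = 0<* (ℚₚ.positive⁻¹ ½) 0<ε

    half+half : ∀ ε → ½ * ε + ½ * ε ≡ ε
    half+half = solve 1 (λ ε → con ½ :* ε :+ con ½ :* ε := ε) refl

    shrink : ∀ n {ε} → 0ℚ < ε → ∃[ δ ] 0ℚ < δ × ofℕ n * δ ≤ ε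
    shrink n {ε} 0<ε = 1/1+ n * ε , 0<* (0<1/1+ n) 0<ε , (begin
      ofℕ n * (1/1+ n * ε)  ≡⟨ ℚₚ.*-assoc (ofℕ n) (1/1+ n) ε ⟨
      ofℕ n * 1/1+ n * ε    ≤⟨ *-mono-≤ (ℚₚ.nonNegative⁻¹ 1ℚ) (ℚₚ.<⇒≤ 0<ε) (ofℕ*1/1+≤1 (ℕₚ.n≤1+n n)) ℚₚ.≤-refl ⟩
      1ℚ * ε                ≡⟨ ℚₚ.*-identityˡ ε ⟩
      ε                     ∎)
      where open ℚₚ.≤-Reasoning

    ≤∣∣ : ∀ i → i ℤ.≤ + ℤ.∣ i ∣
    ≤∣∣ (+ n)      = ℤₚ.≤-refl
    ≤∣∣ ℤ.-[1+ n ] = ℤ.-≤+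

    ≤ofℕ : ∀ q → ∃[ n ] q ≤ ofℕ n
    ≤ofℕ q@(ℚ.mkℚ i d _) = ℤ.∣ i ∣ , ℚₚ.toℚᵘ-cancel-≤ (begin
      toℚᵘ q                  ≤⟨ ℚᵘ.*≤* i*1≤ ⟩
      ℚᵘ.mkℚᵘ (+ ℤ.∣ i ∣) 0   ≃⟨ ℚₚ.toℚᵘ-fromℚᵘ (ℚᵘ.mkℚᵘ (+ ℤ.∣ i ∣) 0) ⟨
      toℚᵘ (ofℕ ℤ.∣ i ∣)      ∎)
      where
      open ℚᵘₚ.≤-Reasoning
      i*1≤ : i ℤ.* 1ℤ ℤ.≤ + ℤ.∣ i ∣ ℤ.* + suc d
      i*1≤ = subst₂ ℤ._≤_ (sym (ℤₚ.*-identityʳ i)) (ℤₚ.pos-* ℤ.∣ i ∣ (suc d))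
        (ℤₚ.≤-trans (≤∣∣ i) (ℤ.+≤+ (ℕₚ.m≤m*n ℤ.∣ i ∣ (suc d))))

    archimedes : ∀ q {ε} → 0ℚ < ε → ∃[ n ] q ≤ ofℕ n * ε
    archimedes q {ε} 0<ε = n , (begin
      q                   ≡⟨ ℚₚ.*-identityʳ q ⟨
      q * 1ℚ              ≡⟨ cong (q *_) (ℚₚ.*-inverseˡ ε) ⟨
      q * (ℚ.1/ ε * ε)    ≡⟨ ℚₚ.*-assoc q (ℚ.1/ ε) ε ⟨
      q * ℚ.1/ ε * ε      ≤⟨ ℚₚ.*-monoʳ-≤-nonNeg ε {{ℚ.nonNegative (ℚₚ.<⇒≤ 0<ε)}} (proj₂ (≤ofℕ (q * ℚ.1/ ε))) ⟩
      ofℕ n * ε           ∎)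
      where
      open ℚₚ.≤-Reasoning
      instance
        ε≢0 : ℚ.NonZero ε
        ε≢0 = ℚ.>-nonZero 0<ε
      n : ℕ
      n = proj₁ (≤ofℕ (q * ℚ.1/ ε))

    ∣-∣-swap : ∀ p q → ∣ p - q ∣ ≡ ∣ q - p ∣
    ∣-∣-swap p q = trans (sym (ℚₚ.∣-p∣≡∣p∣ (p - q)))
      (cong ∣_∣ (solve 2 (λ p q → :- (p :- q) := q :- p) refl p q))

    triangle : ∀ p q r → ∣ p - r ∣ ≤ ∣ p - q ∣ + ∣ q - r ∣
    triangle p q r = begin
      ∣ p - r ∣             ≡⟨ cong ∣_∣ (solve 3 (λ p q r → p :- r := (p :- q) :+ (q :- r)) refl p q r) ⟩
      ∣ (p - q) + (q - r) ∣ ≤⟨ ℚₚ.∣p+q∣≤∣p∣+∣q∣ (p - q) (q - r) ⟩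
      ∣ p - q ∣ + ∣ q - r ∣ ∎
      where open ℚₚ.≤-Reasoning

open Rationals

Sequence : Set
Sequence = ℕ → ℚ

-- s ~ t says that s m - t n tends to 0 as m and n tend to infinity
-- independently, so that s ~ s is the Cauchy property and, between Cauchy
-- sequences, s ~ t says that s n - t n tends to 0.
infix 4 _~_
_~_ : Sequence → Sequence → Set
s ~ t = ∀ ε → 0ℚ ℚ.< ε → ∃[ M ] ∀ m n → M ℕ.≤ m → M ℕ.≤ n → ∣ s m ℚ.- t n ∣ ℚ.≤ ε

Cauchy : Sequence → Set
Cauchy s = s ~ s

record ℝ : Set where
  constructor mkℝ
  field
    seq    : Sequence
    cauchy : Cauchy seq

open ℝ

infix 4 _≃_
_≃_ : ℝ → ℝ → Set
x ≃ y = seq x ~ seq y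

module Sequences where

  open import Data.Rational.Base using (_+_; _*_; _-_; -_; _≤_; _<_)
  open +-*-Solver

  abstract

    ~-sym : ∀ {s t} → s ~ t → t ~ s
    ~-sym {s} {t} s~t ε 0<ε with M , h ← s~t ε 0<ε =
      M , λ m n M≤m M≤n → subst (_≤ ε) (∣-∣-swap (s n) (t m)) (h n m M≤n M≤m)

    ~-trans : ∀ {s t u} → s ~ t → t ~ u → s ~ u
    ~-trans {s} {t} {u} s~t t~u ε 0<ε
      with M , h ← s~t (½ * ε) (half 0<ε) | M′ , h′ ← t~u (½ * ε) (half 0<ε) =
      k , λ m n k≤m k≤n → begin
        ∣ s m - u n ∣                 ≤⟨ triangle (s m) (t k) (u n) ⟩
        ∣ s m - t k ∣ + ∣ t k - u n ∣ ≤⟨ ℚₚ.+-mono-≤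
          (h m k (ℕₚ.≤-trans (ℕₚ.m≤m⊔n M M′) k≤m) (ℕₚ.m≤m⊔n M M′))
          (h′ k n (ℕₚ.m≤n⊔m M M′) (ℕₚ.≤-trans (ℕₚ.m≤n⊔m M M′) k≤n)) ⟩
        ½ * ε + ½ * ε                 ≡⟨ half+half ε ⟩
        ε                             ∎
      where
      open ℚₚ.≤-Reasoning
      k : ℕ
      k = M ℕ.⊔ M′

    ~-resp-≗ : ∀ {s s′ t t′} → (∀ n → s n ≡ s′ n) → (∀ n → t n ≡ t′ n) → s ~ t → s′ ~ t′
    ~-resp-≗ s≗s′ t≗t′ s~t ε 0<ε with M , h ← s~t ε 0<ε =
      M , λ m n M≤m M≤n → subst₂ (λ p q → ∣ p - q ∣ ≤ ε) (s≗s′ m) (t≗t′ n) (h m n M≤m M≤n)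

    ~-const : ∀ q → Cauchy (λ _ → q)
    ~-const q ε 0<ε = 0 , λ _ _ _ _ →
      ℚₚ.≤-trans (ℚₚ.≤-reflexive (cong ∣_∣ (ℚₚ.+-inverseʳ q))) (ℚₚ.<⇒≤ 0<ε)

    ~-+ : ∀ {s t u v} → s ~ t → u ~ v → (λ n → s n + u n) ~ (λ n → t n + v n)
    ~-+ {s} {t} {u} {v} s~t u~v ε 0<ε
      with M , h ← s~t (½ * ε) (half 0<ε) | M′ , h′ ← u~v (½ * ε) (half 0<ε) =
      M ℕ.⊔ M′ , λ m n k≤m k≤n → begin
        ∣ (s m + u m) - (t n + v n) ∣   ≡⟨ cong ∣_∣ (solve 4 (λ a b c d → (a :+ b) :- (c :+ d) := (a :- c) :+ (b :- d)) refl (s m) (u m) (t n) (v n)) ⟩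
        ∣ (s m - t n) + (u m - v n) ∣   ≤⟨ ℚₚ.∣p+q∣≤∣p∣+∣q∣ (s m - t n) (u m - v n) ⟩
        ∣ s m - t n ∣ + ∣ u m - v n ∣   ≤⟨ ℚₚ.+-mono-≤
          (h m n (ℕₚ.m⊔n≤o⇒m≤o M M′ k≤m) (ℕₚ.m⊔n≤o⇒m≤o M M′ k≤n))
          (h′ m n (ℕₚ.m⊔n≤o⇒n≤o M M′ k≤m) (ℕₚ.m⊔n≤o⇒n≤o M M′ k≤n)) ⟩
        ½ * ε + ½ * ε                   ≡⟨ half+half ε ⟩
        ε                               ∎
      where open ℚₚ.≤-Reasoning

    ~-neg : ∀ {s t} → s ~ t → (λ n → - s n) ~ (λ n → - t n)
    ~-neg {s} {t} s~t ε 0<ε with M , h ← s~t ε 0<ε =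
      M , λ m n M≤m M≤n → subst (_≤ ε)
        (trans (∣-∣-swap (s m) (t n))
          (cong ∣_∣ (solve 2 (λ a b → b :- a := :- a :- :- b) refl (s m) (t n))))
        (h m n M≤m M≤n)

    bounded : ∀ {s t} → s ~ t → ∃₂ λ B M → ∀ m → M ℕ.≤ m → ∣ s m ∣ ≤ ofℕ B
    bounded {s} {t} s~t with M , h ← s~t 1ℚ (ℚₚ.positive⁻¹ 1ℚ) =
      proj₁ (≤ofℕ (1ℚ + ∣ t M ∣)) , M , λ m M≤m → begin
        ∣ s m ∣                 ≡⟨ cong ∣_∣ (solve 2 (λ a b → a := (a :- b) :+ b) refl (s m) (t M)) ⟩
        ∣ (s m - t M) + t M ∣   ≤⟨ ℚₚ.∣p+q∣≤∣p∣+∣q∣ (s m - t M) (t M) ⟩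
        ∣ s m - t M ∣ + ∣ t M ∣ ≤⟨ ℚₚ.+-monoˡ-≤ ∣ t M ∣ (h m M M≤m ℕₚ.≤-refl) ⟩
        1ℚ + ∣ t M ∣            ≤⟨ proj₂ (≤ofℕ (1ℚ + ∣ t M ∣)) ⟩
        ofℕ (proj₁ (≤ofℕ (1ℚ + ∣ t M ∣))) ∎
      where open ℚₚ.≤-Reasoning

    *-close : ∀ {a b c d B B′ δ δ′ ε} →
      ∣ a ∣ ≤ ofℕ B → ∣ d ∣ ≤ ofℕ B′ → ∣ b - d ∣ ≤ δ → ∣ a - c ∣ ≤ δ′ →
      ofℕ B * δ ≤ ½ * ε → ofℕ B′ * δ′ ≤ ½ * ε → ∣ a * b - c * d ∣ ≤ ε
    *-close {a} {b} {c} {d} {B} {B′} {δ} {δ′} {ε} a≤B d≤B′ b-d≤δ a-c≤δ′ Bδ≤ B′δ′≤ = begin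
      ∣ a * b - c * d ∣
        ≡⟨ cong ∣_∣ (solve 4 (λ a b c d → a :* b :- c :* d := a :* (b :- d) :+ d :* (a :- c)) refl a b c d) ⟩
      ∣ a * (b - d) + d * (a - c) ∣
        ≤⟨ ℚₚ.∣p+q∣≤∣p∣+∣q∣ (a * (b - d)) (d * (a - c)) ⟩
      ∣ a * (b - d) ∣ + ∣ d * (a - c) ∣
        ≡⟨ cong₂ _+_ (ℚₚ.∣p*q∣≡∣p∣*∣q∣ a (b - d)) (ℚₚ.∣p*q∣≡∣p∣*∣q∣ d (a - c)) ⟩
      ∣ a ∣ * ∣ b - d ∣ + ∣ d ∣ * ∣ a - c ∣
        ≤⟨ ℚₚ.+-mono-≤
          (*-mono-≤ (0≤ofℕ B) (ℚₚ.0≤∣p∣ (b - d)) a≤B b-d≤δ)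
          (*-mono-≤ (0≤ofℕ B′) (ℚₚ.0≤∣p∣ (a - c)) d≤B′ a-c≤δ′) ⟩
      ofℕ B * δ + ofℕ B′ * δ′
        ≤⟨ ℚₚ.+-mono-≤ Bδ≤ B′δ′≤ ⟩
      ½ * ε + ½ * ε
        ≡⟨ half+half ε ⟩
      ε ∎
      where open ℚₚ.≤-Reasoning

    ~-* : ∀ {s t u v} → s ~ t → u ~ v → (λ n → s n * u n) ~ (λ n → t n * v n)
    ~-* {s} {t} {u} {v} s~t u~v ε 0<ε =
      let B , K , bs         = bounded {s} {t} s~t
          B′ , K′ , bv       = bounded {v} {u} (~-sym {u} {v} u~v)
          δ , 0<δ , Bδ≤      = shrink B (half 0<ε)
          δ′ , 0<δ′ , B′δ′≤  = shrink B′ (half 0<ε)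
          M , h              = s~t δ′ 0<δ′
          M′ , h′            = u~v δ 0<δ
      in (K ℕ.⊔ K′) ℕ.⊔ (M ℕ.⊔ M′) , λ m n k≤m k≤n →
      *-close {s m} {u m} {t n} {v n} {B} {B′}
        (bs m (ℕₚ.m⊔n≤o⇒m≤o K K′ (ℕₚ.m⊔n≤o⇒m≤o (K ℕ.⊔ K′) (M ℕ.⊔ M′) k≤m)))
        (bv n (ℕₚ.m⊔n≤o⇒n≤o K K′ (ℕₚ.m⊔n≤o⇒m≤o (K ℕ.⊔ K′) (M ℕ.⊔ M′) k≤n)))
        (h′ m n (ℕₚ.m⊔n≤o⇒n≤o M M′ (ℕₚ.m⊔n≤o⇒n≤o (K ℕ.⊔ K′) (M ℕ.⊔ M′) k≤m)) (ℕₚ.m⊔n≤o⇒n≤o M M′ (ℕₚ.m⊔n≤o⇒n≤o (K ℕ.⊔ K′) (M ℕ.⊔ M′) k≤n)))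
        (h m n (ℕₚ.m⊔n≤o⇒m≤o M M′ (ℕₚ.m⊔n≤o⇒n≤o (K ℕ.⊔ K′) (M ℕ.⊔ M′) k≤m)) (ℕₚ.m⊔n≤o⇒m≤o M M′ (ℕₚ.m⊔n≤o⇒n≤o (K ℕ.⊔ K′) (M ℕ.⊔ M′) k≤n)))
        Bδ≤ B′δ′≤

open Sequences

Σ< : (ℕ → ℚ) → Sequence
Σ< f zero    = 0ℚ
Σ< f (suc n) = Σ< f n ℚ.+ f n

module Series where

  open import Data.Rational.Base using (_+_; _*_; _-_; -_; _≤_; _<_)
  open +-*-Solver

  HalvesFrom : ℕ → (ℕ → ℚ) → Set
  HalvesFrom K g = ∀ k → K ℕ.≤ k → g (suc k) + g (suc k) ≤ g k

  abstract

    Σ<-~ : ∀ (F G : ℕ → Sequence) → (∀ k → F k ~ G k) → ∀ L →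
           (λ n → Σ< (λ k → F k n) L) ~ (λ n → Σ< (λ k → G k n) L)
    Σ<-~ F G F~G zero    = ~-const 0ℚ
    Σ<-~ F G F~G (suc L) =
      ~-+ {λ n → Σ< (λ k → F k n) L} {λ n → Σ< (λ k → G k n) L} {F L} {G L}
        (Σ<-~ F G F~G L) (F~G L)

    module _ (f g : ℕ → ℚ) (f≤g : ∀ k → ∣ f k ∣ ≤ g k) where

      0≤g : ∀ k → 0ℚ ≤ g k
      0≤g k = ℚₚ.≤-trans (ℚₚ.0≤∣p∣ (f k)) (f≤g k)

      tail+ : ∀ K → HalvesFrom K g → ∀ j →
        ∣ Σ< f (j ℕ.+ K) - Σ< f K ∣ + (g (j ℕ.+ K) + g (j ℕ.+ K)) ≤ g K + g K
      tail+ K halves zero = ℚₚ.≤-reflexive (begin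
        ∣ Σ< f K - Σ< f K ∣ + (g K + g K)  ≡⟨ cong (λ q → ∣ q ∣ + (g K + g K)) (ℚₚ.+-inverseʳ (Σ< f K)) ⟩
        0ℚ + (g K + g K)                   ≡⟨ ℚₚ.+-identityˡ (g K + g K) ⟩
        g K + g K                          ∎)
        where open ≡-Reasoning
      tail+ K halves (suc j) = begin
        ∣ S + f m - S₀ ∣ + (g (suc m) + g (suc m))
          ≤⟨ ℚₚ.+-mono-≤ (ℚₚ.≤-trans
               (ℚₚ.≤-reflexive (cong ∣_∣ (solve 3 (λ a b c → a :+ b :- c := (a :- c) :+ b) refl S (f m) S₀)))
               (ℚₚ.∣p+q∣≤∣p∣+∣q∣ (S - S₀) (f m)))
             (halves m (ℕₚ.m≤n+m K j)) ⟩
        ∣ S - S₀ ∣ + ∣ f m ∣ + g m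
          ≤⟨ ℚₚ.+-monoˡ-≤ (g m) (ℚₚ.+-monoʳ-≤ ∣ S - S₀ ∣ (f≤g m)) ⟩
        ∣ S - S₀ ∣ + g m + g m
          ≡⟨ ℚₚ.+-assoc ∣ S - S₀ ∣ (g m) (g m) ⟩
        ∣ S - S₀ ∣ + (g m + g m)
          ≤⟨ tail+ K halves j ⟩
        g K + g K ∎
        where
        open ℚₚ.≤-Reasoning
        m : ℕ
        m = j ℕ.+ K
        S S₀ : ℚ
        S  = Σ< f m
        S₀ = Σ< f K

      tail : ∀ K → HalvesFrom K g → ∀ m → K ℕ.≤ m → ∣ Σ< f m - Σ< f K ∣ ≤ g K + g K
      tail K halves m K≤m = begin
        ∣ Σ< f m - Σ< f K ∣               ≡⟨ cong (λ m → ∣ Σ< f m - Σ< f K ∣) (ℕₚ.m∸n+n≡m K≤m) ⟨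
        ∣ Σ< f m′ - Σ< f K ∣              ≡⟨ ℚₚ.+-identityʳ ∣ Σ< f m′ - Σ< f K ∣ ⟨
        ∣ Σ< f m′ - Σ< f K ∣ + 0ℚ         ≤⟨ ℚₚ.+-monoʳ-≤ ∣ Σ< f m′ - Σ< f K ∣ (0≤+ (0≤g m′) (0≤g m′)) ⟩
        ∣ Σ< f m′ - Σ< f K ∣ + (g m′ + g m′) ≤⟨ tail+ K halves (m ℕ.∸ K) ⟩
        g K + g K                         ∎
        where
        open ℚₚ.≤-Reasoning
        m′ : ℕ
        m′ = m ℕ.∸ K ℕ.+ K

    module _ (g : ℕ → ℚ) (0≤g : ∀ k → 0ℚ ≤ g k) (K : ℕ) (halves : HalvesFrom K g) where

      linear-decay : ∀ j → ofℕ (suc j) * g (j ℕ.+ K) ≤ g K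
      linear-decay zero    = ℚₚ.≤-reflexive (ℚₚ.*-identityˡ (g K))
      linear-decay (suc j) = begin
        ofℕ (suc (suc j)) * g′      ≡⟨ cong (_* g′) (trans (ofℕ-suc (suc j)) (cong (λ q → 1ℚ + q) (ofℕ-suc j))) ⟩
        (1ℚ + (1ℚ + c)) * g′        ≡⟨ solve 2 (λ c g → (con 1ℚ :+ (con 1ℚ :+ c)) :* g := g :+ g :+ c :* g :+ con 0ℚ) refl c g′ ⟩
        g′ + g′ + c * g′ + 0ℚ       ≤⟨ ℚₚ.+-monoʳ-≤ (g′ + g′ + c * g′) (0≤* (0≤ofℕ j) (0≤g _)) ⟩
        g′ + g′ + c * g′ + c * g′   ≡⟨ solve 2 (λ c g → g :+ g :+ c :* g :+ c :* g := (con 1ℚ :+ c) :* (g :+ g)) refl c g′ ⟩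
        (1ℚ + c) * (g′ + g′)        ≡⟨ cong (_* (g′ + g′)) (ofℕ-suc j) ⟨
        ofℕ (suc j) * (g′ + g′)     ≤⟨ *-mono-≤ (0≤ofℕ (suc j)) (0≤+ (0≤g _) (0≤g _)) ℚₚ.≤-refl (halves (j ℕ.+ K) (ℕₚ.m≤n+m K j)) ⟩
        ofℕ (suc j) * g (j ℕ.+ K)   ≤⟨ linear-decay j ⟩
        g K                         ∎
        where
        open ℚₚ.≤-Reasoning
        c g′ : ℚ
        c  = ofℕ j
        g′ = g (suc (j ℕ.+ K))

      decay : ∀ ε → 0ℚ < ε → ∃[ L ] K ℕ.≤ L × g L + g L ≤ ε
      decay ε 0<ε =
        let n , gK≤ = archimedes (g K) (half 0<ε) in
        n ℕ.+ K , ℕₚ.m≤n+m K n ,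
        ℚₚ.≤-trans (ℚₚ.+-mono-≤ (small n gK≤) (small n gK≤)) (ℚₚ.≤-reflexive (half+half ε))
        where
        small : ∀ n → g K ≤ ofℕ n * (½ * ε) → g (n ℕ.+ K) ≤ ½ * ε
        small n gK≤ = ℚₚ.*-cancelˡ-≤-pos (ofℕ (suc n)) {{ℚ.positive 0<1+n}} (begin
          ofℕ (suc n) * g (n ℕ.+ K) ≤⟨ linear-decay n ⟩
          g K                       ≤⟨ gK≤ ⟩
          ofℕ n * (½ * ε)           ≤⟨ *-mono-≤ (0≤ofℕ (suc n)) (ℚₚ.<⇒≤ (half 0<ε)) (ofℕ-mono (ℕₚ.n≤1+n n)) ℚₚ.≤-refl ⟩
          ofℕ (suc n) * (½ * ε)     ∎)
          where
          open ℚₚ.≤-Reasoning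
          0<1+n : 0ℚ < ofℕ (suc n)
          0<1+n = ℚₚ.<-≤-trans (ℚₚ.positive⁻¹ 1ℚ) (ofℕ-mono {1} {suc n} (ℕ.s≤s ℕ.z≤n))

    three-parts : ∀ {p p₀ q₀ q ε} → ∣ p - p₀ ∣ ≤ ½ * (½ * ε) → ∣ p₀ - q₀ ∣ ≤ ½ * ε →
      ∣ q - q₀ ∣ ≤ ½ * (½ * ε) → ∣ p - q ∣ ≤ ε
    three-parts {p} {p₀} {q₀} {q} {ε} a b c = begin
      ∣ p - q ∣                                       ≤⟨ triangle p p₀ q ⟩
      ∣ p - p₀ ∣ + ∣ p₀ - q ∣                         ≤⟨ ℚₚ.+-monoʳ-≤ ∣ p - p₀ ∣ (triangle p₀ q₀ q) ⟩
      ∣ p - p₀ ∣ + (∣ p₀ - q₀ ∣ + ∣ q₀ - q ∣)         ≡⟨ cong (λ d → ∣ p - p₀ ∣ + (∣ p₀ - q₀ ∣ + d)) (∣-∣-swap q₀ q) ⟩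
      ∣ p - p₀ ∣ + (∣ p₀ - q₀ ∣ + ∣ q - q₀ ∣)         ≤⟨ ℚₚ.+-mono-≤ a (ℚₚ.+-mono-≤ b c) ⟩
      ½ * (½ * ε) + (½ * ε + ½ * (½ * ε))             ≡⟨ solve 1 (λ ε → con ½ :* (con ½ :* ε) :+ (con ½ :* ε :+ con ½ :* (con ½ :* ε)) := ε) refl ε ⟩
      ε                                               ∎
      where open ℚₚ.≤-Reasoning

    Σ<-cauchy : ∀ (g : ℕ → ℚ) → (∀ k → 0ℚ ≤ g k) → HalvesFrom 0 g → Cauchy (Σ< g)
    Σ<-cauchy g 0≤g halves ε 0<ε =
      let L , _ , small = decay g 0≤g 0 halves (½ * (½ * ε)) (half (half 0<ε))
          close = λ m L≤m → ℚₚ.≤-trans (tail g g (λ k → ℚₚ.≤-reflexive (ℚₚ.0≤p⇒∣p∣≡p (0≤g k))) L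
                    (λ k _ → halves k ℕ.z≤n) m L≤m) small
      in L , λ m n L≤m L≤n → three-parts {Σ< g m} {Σ< g L} {Σ< g L} {Σ< g n}
        (close m L≤m)
        (ℚₚ.≤-trans (ℚₚ.≤-reflexive (cong ∣_∣ (ℚₚ.+-inverseʳ (Σ< g L)))) (ℚₚ.<⇒≤ (half 0<ε)))
        (close n L≤n)

open Series

-- π = 2 Σ k! / (2k + 1)!!, whose terms have ratio (k + 1) / (2k + 3).
πTerm : ℕ → ℚ
πTerm zero    = + 2 / 1
πTerm (suc k) = πTerm k ℚ.* (+ suc k / suc (suc k ℕ.+ suc k))

-- z ^ k / k! for z = a + b ı
mutual
  reTerm : ℕ → ℚ → ℚ → ℚ
  reTerm zero    a b = 1ℚ
  reTerm (suc k) a b = (reTerm k a b ℚ.* a ℚ.- imTerm k a b ℚ.* b) ℚ.* (1ℤ / suc k)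

  imTerm : ℕ → ℚ → ℚ → ℚ
  imTerm zero    a b = 0ℚ
  imTerm (suc k) a b = (reTerm k a b ℚ.* b ℚ.+ imTerm k a b ℚ.* a) ℚ.* (1ℤ / suc k)

module Exponential where

  open import Data.Rational.Base using (_+_; _*_; _-_; -_; _≤_; _<_)
  open +-*-Solver

  -- B ^ k / k!
  expBound : ℕ → ℕ → ℚ
  expBound B zero    = 1ℚ
  expBound B (suc k) = expBound B k * (ofℕ B * 1/1+ k)

  expSum : (ℕ → ℚ → ℚ → ℚ) → Sequence → Sequence → Sequence
  expSum T a b n = Σ< (λ k → T k (a n) (b n)) n

  abstract

    0≤expBound : ∀ B k → 0ℚ ≤ expBound B k
    0≤expBound B zero    = ℚₚ.nonNegative⁻¹ 1ℚ
    0≤expBound B (suc k) = 0≤* (0≤expBound B k) (0≤* (0≤ofℕ B) (0≤1/1+ k))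

    double≤ : ∀ {g} B k → 0ℚ ≤ g → B ℕ.+ B ℕ.≤ suc k →
      g * (ofℕ B * 1/1+ k) + g * (ofℕ B * 1/1+ k) ≤ g
    double≤ {g} B k 0≤g 2B≤ = begin
      g * (ofℕ B * 1/1+ k) + g * (ofℕ B * 1/1+ k)
        ≡⟨ solve 3 (λ g b i → g :* (b :* i) :+ g :* (b :* i) := g :* ((b :+ b) :* i)) refl g (ofℕ B) (1/1+ k) ⟩
      g * ((ofℕ B + ofℕ B) * 1/1+ k)
        ≡⟨ cong (λ b → g * (b * 1/1+ k)) (ofℕ-+ B B) ⟨
      g * (ofℕ (B ℕ.+ B) * 1/1+ k)
        ≤⟨ ℚₚ.*-monoˡ-≤-nonNeg g {{ℚ.nonNegative 0≤g}} (ofℕ*1/1+≤1 2B≤) ⟩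
      g * 1ℚ
        ≡⟨ ℚₚ.*-identityʳ g ⟩
      g ∎
      where open ℚₚ.≤-Reasoning

    expBound-halves : ∀ B → HalvesFrom (B ℕ.+ B) (expBound B)
    expBound-halves B k 2B≤k = double≤ B k (0≤expBound B k) (ℕₚ.m≤n⇒m≤1+n 2B≤k)

    ∣*∣+∣*∣ : ∀ p q r s → ∣ p * q + r * s ∣ ≤ ∣ p ∣ * ∣ q ∣ + ∣ r ∣ * ∣ s ∣
    ∣*∣+∣*∣ p q r s = ℚₚ.≤-trans (ℚₚ.∣p+q∣≤∣p∣+∣q∣ (p * q) (r * s))
      (ℚₚ.≤-reflexive (cong₂ _+_ (ℚₚ.∣p*q∣≡∣p∣*∣q∣ p q) (ℚₚ.∣p*q∣≡∣p∣*∣q∣ r s)))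

    ∣*∣-∣*∣ : ∀ p q r s → ∣ p * q - r * s ∣ ≤ ∣ p ∣ * ∣ q ∣ + ∣ r ∣ * ∣ s ∣
    ∣*∣-∣*∣ p q r s = ℚₚ.≤-trans (ℚₚ.∣p-q∣≤∣p∣+∣q∣ (p * q) (r * s))
      (ℚₚ.≤-reflexive (cong₂ _+_ (ℚₚ.∣p*q∣≡∣p∣*∣q∣ p q) (ℚₚ.∣p*q∣≡∣p∣*∣q∣ r s)))

    ∣*1/1+∣ : ∀ q k → ∣ q * 1/1+ k ∣ ≡ ∣ q ∣ * 1/1+ k
    ∣*1/1+∣ q k = trans (ℚₚ.∣p*q∣≡∣p∣*∣q∣ q (1/1+ k))
      (cong (∣ q ∣ *_) (ℚₚ.0≤p⇒∣p∣≡p (0≤1/1+ k)))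

    terms≤ : ∀ B {a b} → ∣ a ∣ + ∣ b ∣ ≤ ofℕ B → ∀ k →
      ∣ reTerm k a b ∣ + ∣ imTerm k a b ∣ ≤ expBound B k
    terms≤ B {a} {b} ab≤B zero    = ℚₚ.≤-refl
    terms≤ B {a} {b} ab≤B (suc k) = begin
      ∣ (c * a - d * b) * i ∣ + ∣ (c * b + d * a) * i ∣
        ≡⟨ cong₂ _+_ (∣*1/1+∣ (c * a - d * b) k) (∣*1/1+∣ (c * b + d * a) k) ⟩
      ∣ c * a - d * b ∣ * i + ∣ c * b + d * a ∣ * i
        ≤⟨ ℚₚ.+-mono-≤ (scale (∣*∣-∣*∣ c a d b)) (scale (∣*∣+∣*∣ c b d a)) ⟩
      (∣ c ∣ * ∣ a ∣ + ∣ d ∣ * ∣ b ∣) * i + (∣ c ∣ * ∣ b ∣ + ∣ d ∣ * ∣ a ∣) * i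
        ≡⟨ solve 5 (λ a b c d i → (c :* a :+ d :* b) :* i :+ (c :* b :+ d :* a) :* i
                               := (c :+ d) :* ((a :+ b) :* i)) refl (∣ a ∣) (∣ b ∣) (∣ c ∣) (∣ d ∣) i ⟩
      (∣ c ∣ + ∣ d ∣) * ((∣ a ∣ + ∣ b ∣) * i)
        ≤⟨ *-mono-≤ (0≤expBound B k) (0≤* (0≤+ (ℚₚ.0≤∣p∣ a) (ℚₚ.0≤∣p∣ b)) (0≤1/1+ k))
             (terms≤ B ab≤B k) (scale ab≤B) ⟩
      expBound B k * (ofℕ B * i) ∎
      where
      open ℚₚ.≤-Reasoning
      c d i : ℚ
      c = reTerm k a b
      d = imTerm k a b
      i = 1/1+ k
      scale : ∀ {p q} → p ≤ q → p * i ≤ q * i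
      scale = ℚₚ.*-monoʳ-≤-nonNeg i {{ℚ.nonNegative (0≤1/1+ k)}}

    reTerm≤ : ∀ B {a b} → ∣ a ∣ + ∣ b ∣ ≤ ofℕ B → ∀ k → ∣ reTerm k a b ∣ ≤ expBound B k
    reTerm≤ B {a} {b} ab≤B k = ℚₚ.≤-trans
      (ℚₚ.≤-trans (ℚₚ.≤-reflexive (sym (ℚₚ.+-identityʳ ∣ reTerm k a b ∣)))
        (ℚₚ.+-monoʳ-≤ ∣ reTerm k a b ∣ (ℚₚ.0≤∣p∣ (imTerm k a b))))
      (terms≤ B ab≤B k)

    imTerm≤ : ∀ B {a b} → ∣ a ∣ + ∣ b ∣ ≤ ofℕ B → ∀ k → ∣ imTerm k a b ∣ ≤ expBound B k
    imTerm≤ B {a} {b} ab≤B k = ℚₚ.≤-trans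
      (ℚₚ.≤-trans (ℚₚ.≤-reflexive (sym (ℚₚ.+-identityˡ ∣ imTerm k a b ∣)))
        (ℚₚ.+-monoˡ-≤ ∣ imTerm k a b ∣ (ℚₚ.0≤∣p∣ (reTerm k a b))))
      (terms≤ B ab≤B k)

    module _ {a a′ b b′ : Sequence} (a~a′ : a ~ a′) (b~b′ : b ~ b′) where

      terms-~ : ∀ k →
        (λ n → reTerm k (a n) (b n)) ~ (λ n → reTerm k (a′ n) (b′ n)) ×
        (λ n → imTerm k (a n) (b n)) ~ (λ n → imTerm k (a′ n) (b′ n))
      terms-~ zero    = ~-const 1ℚ , ~-const 0ℚ
      terms-~ (suc k) =
        let c = λ n → reTerm k (a n) (b n)
            d = λ n → imTerm k (a n) (b n)
            c′ = λ n → reTerm k (a′ n) (b′ n)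
            d′ = λ n → imTerm k (a′ n) (b′ n)
            c~c′ , d~d′ = terms-~ k
        in ~-* {λ n → c n * a n - d n * b n} {λ n → c′ n * a′ n - d′ n * b′ n} {λ _ → 1/1+ k} {λ _ → 1/1+ k}
             (~-+ {λ n → c n * a n} {λ n → c′ n * a′ n} {λ n → - (d n * b n)} {λ n → - (d′ n * b′ n)}
               (~-* {c} {c′} {a} {a′} c~c′ a~a′)
               (~-neg {λ n → d n * b n} {λ n → d′ n * b′ n} (~-* {d} {d′} {b} {b′} d~d′ b~b′)))
             (~-const (1/1+ k))
         , ~-* {λ n → c n * b n + d n * a n} {λ n → c′ n * b′ n + d′ n * a′ n} {λ _ → 1/1+ k} {λ _ → 1/1+ k}
             (~-+ {λ n → c n * b n} {λ n → c′ n * b′ n} {λ n → d n * a n} {λ n → d′ n * a′ n}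
               (~-* {c} {c′} {b} {b′} c~c′ b~b′) (~-* {d} {d′} {a} {a′} d~d′ a~a′))
             (~-const (1/1+ k))

      norm-bounded : ∃₂ λ B M → ∀ m → M ℕ.≤ m → ∣ a m ∣ + ∣ b m ∣ ≤ ofℕ B
      norm-bounded =
        let B , M , ha = bounded {a} {a′} a~a′
            C , N , hb = bounded {b} {b′} b~b′
        in B ℕ.+ C , M ℕ.⊔ N , λ m k≤m → ℚₚ.≤-trans
          (ℚₚ.+-mono-≤ (ha m (ℕₚ.m⊔n≤o⇒m≤o M N k≤m)) (hb m (ℕₚ.m⊔n≤o⇒n≤o M N k≤m)))
          (ℚₚ.≤-reflexive (sym (ofℕ-+ B C)))

    expSum-~ : ∀ {a a′ b b′} (T : ℕ → ℚ → ℚ → ℚ) →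
      (∀ B {p q} → ∣ p ∣ + ∣ q ∣ ≤ ofℕ B → ∀ k → ∣ T k p q ∣ ≤ expBound B k) →
      (∀ k → (λ n → T k (a n) (b n)) ~ (λ n → T k (a′ n) (b′ n))) →
      a ~ a′ → b ~ b′ → expSum T a b ~ expSum T a′ b′
    expSum-~ {a} {a′} {b} {b′} T T≤ T~ a~a′ b~b′ ε 0<ε =
      let B , N , h     = norm-bounded {a} {a′} {b} {b′} a~a′ b~b′
          B′ , N′ , h′  = norm-bounded {a′} {a} {b′} {b} (~-sym {a} {a′} a~a′) (~-sym {b} {b′} b~b′)
          C             = B ℕ.+ B′
          L , 2C≤L , small = decay (expBound C) (0≤expBound C) (C ℕ.+ C) (expBound-halves C)
                               (½ * (½ * ε)) (half (half 0<ε))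
          M , close = Σ<-~ (λ k n → T k (a n) (b n)) (λ k n → T k (a′ n) (b′ n)) T~ L (½ * ε) (half 0<ε)
          rest : ∀ {p q} → ∣ p ∣ + ∣ q ∣ ≤ ofℕ C → ∀ m → L ℕ.≤ m →
                 ∣ Σ< (λ k → T k p q) m - Σ< (λ k → T k p q) L ∣ ≤ ½ * (½ * ε)
          rest = λ {p} {q} pq≤C m L≤m → ℚₚ.≤-trans
            (tail (λ k → T k p q) (expBound C) (T≤ C pq≤C) L
              (λ k L≤k → expBound-halves C k (ℕₚ.≤-trans 2C≤L L≤k)) m L≤m)
            small
      in (N ℕ.⊔ N′) ℕ.⊔ (L ℕ.⊔ M) , λ m n k≤m k≤n →
        let NN≤m = ℕₚ.m⊔n≤o⇒m≤o (N ℕ.⊔ N′) (L ℕ.⊔ M) k≤m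
            NN≤n = ℕₚ.m⊔n≤o⇒m≤o (N ℕ.⊔ N′) (L ℕ.⊔ M) k≤n
            LM≤m = ℕₚ.m⊔n≤o⇒n≤o (N ℕ.⊔ N′) (L ℕ.⊔ M) k≤m
            LM≤n = ℕₚ.m⊔n≤o⇒n≤o (N ℕ.⊔ N′) (L ℕ.⊔ M) k≤n
        in three-parts
          {Σ< (λ k → T k (a m) (b m)) m} {Σ< (λ k → T k (a m) (b m)) L}
          {Σ< (λ k → T k (a′ n) (b′ n)) L} {Σ< (λ k → T k (a′ n) (b′ n)) n}
          (rest (ℚₚ.≤-trans (h m (ℕₚ.m⊔n≤o⇒m≤o N N′ NN≤m)) (ofℕ-mono (ℕₚ.m≤m+n B B′)))
            m (ℕₚ.m⊔n≤o⇒m≤o L M LM≤m))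
          (close m n (ℕₚ.m⊔n≤o⇒n≤o L M LM≤m) (ℕₚ.m⊔n≤o⇒n≤o L M LM≤n))
          (rest (ℚₚ.≤-trans (h′ n (ℕₚ.m⊔n≤o⇒n≤o N N′ NN≤n)) (ofℕ-mono (ℕₚ.m≤n+m B′ B)))
            n (ℕₚ.m⊔n≤o⇒m≤o L M LM≤n))

    expRe-~ : ∀ {a a′ b b′} → a ~ a′ → b ~ b′ → expSum reTerm a b ~ expSum reTerm a′ b′
    expRe-~ {a} {a′} {b} {b′} a~a′ b~b′ = expSum-~ {a} {a′} {b} {b′} reTerm reTerm≤
      (λ k → proj₁ (terms-~ {a} {a′} {b} {b′} a~a′ b~b′ k)) a~a′ b~b′

    expIm-~ : ∀ {a a′ b b′} → a ~ a′ → b ~ b′ → expSum imTerm a b ~ expSum imTerm a′ b′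
    expIm-~ {a} {a′} {b} {b′} a~a′ b~b′ = expSum-~ {a} {a′} {b} {b′} imTerm imTerm≤
      (λ k → proj₂ (terms-~ {a} {a′} {b} {b′} a~a′ b~b′ k)) a~a′ b~b′

    k/d≡ : ∀ k → + suc k / suc (suc k ℕ.+ suc k) ≡ ofℕ (suc k) * 1/1+ (suc k ℕ.+ suc k)
    k/d≡ k = ℚₚ.toℚᵘ-injective (begin-equality
      toℚᵘ (+ suc k / suc e)
        ≃⟨ ℚₚ.toℚᵘ-fromℚᵘ (ℚᵘ.mkℚᵘ (+ suc k) e) ⟩
      ℚᵘ.mkℚᵘ (+ suc k) e
        ≃⟨ ℚᵘ.*≡* (cong₂ ℤ._*_ (sym (ℤₚ.*-identityʳ (+ suc k))) (cong +_ (ℕₚ.*-identityˡ (suc e)))) ⟩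
      ℚᵘ.mkℚᵘ (+ suc k) 0 ℚᵘ.* ℚᵘ.mkℚᵘ 1ℤ e
        ≃⟨ ℚᵘₚ.*-cong (ℚₚ.toℚᵘ-fromℚᵘ (ℚᵘ.mkℚᵘ (+ suc k) 0)) (ℚₚ.toℚᵘ-fromℚᵘ (ℚᵘ.mkℚᵘ 1ℤ e)) ⟨
      toℚᵘ (ofℕ (suc k)) ℚᵘ.* toℚᵘ (1/1+ e)
        ≃⟨ ℚₚ.toℚᵘ-homo-* (ofℕ (suc k)) (1/1+ e) ⟨
      toℚᵘ (ofℕ (suc k) * 1/1+ e) ∎)
      where
      open ℚᵘₚ.≤-Reasoning
      e : ℕ
      e = suc k ℕ.+ suc k

    0≤πTerm : ∀ k → 0ℚ ≤ πTerm k
    0≤πTerm zero    = ℚₚ.nonNegative⁻¹ (+ 2 / 1)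
    0≤πTerm (suc k) = 0≤* (0≤πTerm k)
      (subst (0ℚ ≤_) (sym (k/d≡ k)) (0≤* (0≤ofℕ (suc k)) (0≤1/1+ (suc k ℕ.+ suc k))))

    πTerm-halves : HalvesFrom 0 πTerm
    πTerm-halves k _ = subst (λ r → πTerm k * r + πTerm k * r ≤ πTerm k) (sym (k/d≡ k))
      (double≤ (suc k) (suc k ℕ.+ suc k) (0≤πTerm k) (ℕₚ.n≤1+n (suc k ℕ.+ suc k)))

    π-cauchy : Cauchy (Σ< πTerm)
    π-cauchy = Σ<-cauchy πTerm 0≤πTerm πTerm-halves

open Exponential

module _ where

  open import Data.Rational.Base using (_+_; _*_; -_)

  fromℚ : ℚ → ℝ
  fromℚ q = mkℝ (λ _ → q) (~-const q)

  π : ℝ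
  π = mkℝ (Σ< πTerm) π-cauchy

  infixl 6 _+ᴿ_
  infixl 7 _*ᴿ_
  infix  8 -ᴿ_

  _+ᴿ_ : ℝ → ℝ → ℝ
  mkℝ s cs +ᴿ mkℝ t ct = mkℝ (λ n → s n + t n) (~-+ {s} {s} {t} {t} cs ct)

  _*ᴿ_ : ℝ → ℝ → ℝ
  mkℝ s cs *ᴿ mkℝ t ct = mkℝ (λ n → s n * t n) (~-* {s} {s} {t} {t} cs ct)

  -ᴿ_ : ℝ → ℝ
  -ᴿ mkℝ s cs = mkℝ (λ n → - s n) (~-neg {s} {s} cs)

record ℂ : Set where
  constructor _+ı_
  field
    re im : ℝ

open ℂ

module Complex where

  infix  4 _≈_
  infixl 6 _+_
  infixl 7 _*_
  infix  8 -_

  record _≈_ (z w : ℂ) : Set where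
    constructor _,_
    field
      re-≃ : re z ≃ re w
      im-≃ : im z ≃ im w

  _+_ _*_ : ℂ → ℂ → ℂ
  z + w = (re z +ᴿ re w) +ı (im z +ᴿ im w)
  z * w = (re z *ᴿ re w +ᴿ -ᴿ (im z *ᴿ im w)) +ı (re z *ᴿ im w +ᴿ im z *ᴿ re w)

  -_ : ℂ → ℂ
  - z = (-ᴿ re z) +ı (-ᴿ im z)

  fromℝ : ℝ → ℂ
  fromℝ x = x +ı fromℚ 0ℚ

  0# 1# ı : ℂ
  0# = fromℝ (fromℚ 0ℚ)
  1# = fromℝ (fromℚ 1ℚ)
  ı  = fromℚ 0ℚ +ı fromℚ 1ℚ

  -- The n-th rational approximation is Σ_{k<n} z_n ^ k / k!, where z_n is the
  -- n-th approximation of z.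
  exp : ℂ → ℂ
  exp (x +ı y) =
    mkℝ (expSum reTerm (seq x) (seq y)) (expRe-~ {seq x} {seq x} {seq y} {seq y} (cauchy x) (cauchy y)) +ı
    mkℝ (expSum imTerm (seq x) (seq y)) (expIm-~ {seq x} {seq x} {seq y} {seq y} (cauchy x) (cauchy y))

  module _ where

    open +-*-Solver

    abstract

      pointwise : ∀ {z w} → (∀ n → seq (re z) n ≡ seq (re w) n) →
                  (∀ n → seq (im z) n ≡ seq (im w) n) → z ≈ w
      pointwise {z} {w} r i =
        ~-resp-≗ {seq (re z)} {seq (re z)} (λ _ → refl) r (cauchy (re z)) ,
        ~-resp-≗ {seq (im z)} {seq (im z)} (λ _ → refl) i (cauchy (im z))

      ≈-refl : ∀ {z} → z ≈ z
      ≈-refl {z} = cauchy (re z) , cauchy (im z)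

      ≈-sym : ∀ {z w} → z ≈ w → w ≈ z
      ≈-sym {z} {w} (r , i) =
        ~-sym {seq (re z)} {seq (re w)} r , ~-sym {seq (im z)} {seq (im w)} i

      ≈-trans : ∀ {z w v} → z ≈ w → w ≈ v → z ≈ v
      ≈-trans {z} {w} {v} (r , i) (r′ , i′) =
        ~-trans {seq (re z)} {seq (re w)} {seq (re v)} r r′ ,
        ~-trans {seq (im z)} {seq (im w)} {seq (im v)} i i′

      +ᴿ-cong : ∀ {x x′ y y′} → x ≃ x′ → y ≃ y′ → x +ᴿ y ≃ x′ +ᴿ y′
      +ᴿ-cong {x} {x′} {y} {y′} = ~-+ {seq x} {seq x′} {seq y} {seq y′}

      *ᴿ-cong : ∀ {x x′ y y′} → x ≃ x′ → y ≃ y′ → x *ᴿ y ≃ x′ *ᴿ y′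
      *ᴿ-cong {x} {x′} {y} {y′} = ~-* {seq x} {seq x′} {seq y} {seq y′}

      -ᴿ-cong : ∀ {x x′} → x ≃ x′ → -ᴿ x ≃ -ᴿ x′
      -ᴿ-cong {x} {x′} = ~-neg {seq x} {seq x′}

      +-cong : ∀ {z z′ w w′} → z ≈ z′ → w ≈ w′ → z + w ≈ z′ + w′
      +-cong {z} {z′} {w} {w′} (zr , zi) (wr , wi) =
        +ᴿ-cong {re z} {re z′} {re w} {re w′} zr wr ,
        +ᴿ-cong {im z} {im z′} {im w} {im w′} zi wi

      *-cong : ∀ {z z′ w w′} → z ≈ z′ → w ≈ w′ → z * w ≈ z′ * w′
      *-cong {z} {z′} {w} {w′} (zr , zi) (wr , wi) =
        +ᴿ-cong {re z *ᴿ re w} {re z′ *ᴿ re w′} { -ᴿ (im z *ᴿ im w)} { -ᴿ (im z′ *ᴿ im w′)}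
          (*ᴿ-cong {re z} {re z′} {re w} {re w′} zr wr)
          (-ᴿ-cong {im z *ᴿ im w} {im z′ *ᴿ im w′} (*ᴿ-cong {im z} {im z′} {im w} {im w′} zi wi)) ,
        +ᴿ-cong {re z *ᴿ im w} {re z′ *ᴿ im w′} {im z *ᴿ re w} {im z′ *ᴿ re w′}
          (*ᴿ-cong {re z} {re z′} {im w} {im w′} zr wi)
          (*ᴿ-cong {im z} {im z′} {re w} {re w′} zi wr)

      -‿cong : ∀ {z w} → z ≈ w → - z ≈ - w
      -‿cong {z} {w} (r , i) = -ᴿ-cong {re z} {re w} r , -ᴿ-cong {im z} {im w} i

      exp-cong : ∀ {z w} → z ≈ w → exp z ≈ exp w
      exp-cong {x +ı y} {x′ +ı y′} (r , i) =
        expRe-~ {seq x} {seq x′} {seq y} {seq y′} r i ,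
        expIm-~ {seq x} {seq x′} {seq y} {seq y′} r i

      +-assoc : ∀ z w v → (z + w) + v ≈ z + (w + v)
      +-assoc z w v = pointwise
        (λ n → ℚₚ.+-assoc (seq (re z) n) (seq (re w) n) (seq (re v) n))
        (λ n → ℚₚ.+-assoc (seq (im z) n) (seq (im w) n) (seq (im v) n))

      +-comm : ∀ z w → z + w ≈ w + z
      +-comm z w = pointwise
        (λ n → ℚₚ.+-comm (seq (re z) n) (seq (re w) n))
        (λ n → ℚₚ.+-comm (seq (im z) n) (seq (im w) n))

      +-identityˡ : ∀ z → 0# + z ≈ z
      +-identityˡ z = pointwise
        (λ n → ℚₚ.+-identityˡ (seq (re z) n)) (λ n → ℚₚ.+-identityˡ (seq (im z) n))

      -‿inverseˡ : ∀ z → - z + z ≈ 0#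
      -‿inverseˡ z = pointwise
        (λ n → ℚₚ.+-inverseˡ (seq (re z) n)) (λ n → ℚₚ.+-inverseˡ (seq (im z) n))

      *-assoc : ∀ z w v → (z * w) * v ≈ z * (w * v)
      *-assoc z w v = pointwise
        (λ n → solve 6 (λ a b c d e f → (a :* c :+ :- (b :* d)) :* e :+ :- ((a :* d :+ b :* c) :* f)
                 := a :* (c :* e :+ :- (d :* f)) :+ :- (b :* (c :* f :+ d :* e))) refl
          (seq (re z) n) (seq (im z) n) (seq (re w) n) (seq (im w) n) (seq (re v) n) (seq (im v) n))
        (λ n → solve 6 (λ a b c d e f → (a :* c :+ :- (b :* d)) :* f :+ (a :* d :+ b :* c) :* e
                 := a :* (c :* f :+ d :* e) :+ b :* (c :* e :+ :- (d :* f))) refl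
          (seq (re z) n) (seq (im z) n) (seq (re w) n) (seq (im w) n) (seq (re v) n) (seq (im v) n))

      *-comm : ∀ z w → z * w ≈ w * z
      *-comm z w = pointwise
        (λ n → solve 4 (λ a b c d → a :* c :+ :- (b :* d) := c :* a :+ :- (d :* b)) refl
          (seq (re z) n) (seq (im z) n) (seq (re w) n) (seq (im w) n))
        (λ n → solve 4 (λ a b c d → a :* d :+ b :* c := c :* b :+ d :* a) refl
          (seq (re z) n) (seq (im z) n) (seq (re w) n) (seq (im w) n))

      *-identityˡ : ∀ z → 1# * z ≈ z
      *-identityˡ z = pointwise
        (λ n → solve 2 (λ a b → con 1ℚ :* a :+ :- (con 0ℚ :* b) := a) refl
          (seq (re z) n) (seq (im z) n))
        (λ n → solve 2 (λ a b → con 1ℚ :* b :+ con 0ℚ :* a := b) refl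
          (seq (re z) n) (seq (im z) n))

      distribˡ : ∀ z w v → z * (w + v) ≈ z * w + z * v
      distribˡ z w v = pointwise
        (λ n → solve 6 (λ a b c d e f → a :* (c :+ e) :+ :- (b :* (d :+ f))
                 := (a :* c :+ :- (b :* d)) :+ (a :* e :+ :- (b :* f))) refl
          (seq (re z) n) (seq (im z) n) (seq (re w) n) (seq (im w) n) (seq (re v) n) (seq (im v) n))
        (λ n → solve 6 (λ a b c d e f → a :* (d :+ f) :+ b :* (c :+ e)
                 := (a :* d :+ b :* c) :+ (a :* f :+ b :* e)) refl
          (seq (re z) n) (seq (im z) n) (seq (re w) n) (seq (im w) n) (seq (re v) n) (seq (im v) n))

open Complex using (_≈_; fromℝ; ı; exp)

ℂ-setoid : Setoid 0ℓ 0ℓ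
ℂ-setoid = record
  { Carrier       = ℂ
  ; _≈_           = _≈_
  ; isEquivalence = record
    { refl  = Complex.≈-refl
    ; sym   = Complex.≈-sym
    ; trans = Complex.≈-trans
    }
  }

ℂ-commutativeRing : CommutativeRing 0ℓ 0ℓ
ℂ-commutativeRing = record
  { Carrier = ℂ
  ; _≈_     = _≈_
  ; _+_     = Complex._+_
  ; _*_     = Complex._*_
  ; -_      = Complex.-_
  ; 0#      = Complex.0#
  ; 1#      = Complex.1#
  ; isCommutativeRing = record
    { isRing = record
      { +-isAbelianGroup = record
        { isGroup = record
          { isMonoid = record
            { isSemigroup = record
              { isMagma = record
                { isEquivalence = Setoid.isEquivalence ℂ-setoid
                ; ∙-cong        = Complex.+-cong
                }
              ; assoc = Complex.+-assoc
              }
            ; identity = comm∧idˡ⇒id Complex.+-comm Complex.+-identityˡ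
            }
          ; inverse = comm∧invˡ⇒inv Complex.+-comm Complex.-‿inverseˡ
          ; ⁻¹-cong = Complex.-‿cong
          }
        ; comm = Complex.+-comm
        }
      ; *-cong     = Complex.*-cong
      ; *-assoc    = Complex.*-assoc
      ; *-identity = comm∧idˡ⇒id Complex.*-comm Complex.*-identityˡ
      ; distrib    = comm∧distrˡ⇒distr Complex.+-cong
                       Complex.*-comm Complex.distribˡ
      }
    ; *-comm = Complex.*-comm
    }
  }
  where open import Algebra.Consequences.Setoid ℂ-setoid

open CommutativeRing ℂ-commutativeRing using (_+_; _*_; -_; +-monoid)
open import Algebra.Properties.Monoid.Sum +-monoid using (sum)

Ω : ∀ {N} → Fin N → Fin N → ℂ
Ω {N} k j = exp (- (fromℝ (fromℚ (+ 2 / 1)) * fromℝ π * ı * fromℝ (fromℚ kj/N)))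
  where
  instance
    N≢0 : NonZero N
    N≢0 = nonZeroIndex k
  kj/N : ℚ
  kj/N = + (toℕ k ℕ.* toℕ j) / N

DFT : ∀ {N} → (Fin N → ℂ) → (Fin N → ℂ)
DFT x k = sum (λ j → Ω k j * x j)

infixr 5 _⇒ₛ_
_⇒ₛ_ : ∀ {a c ℓ} → Set a → Setoid c ℓ → Setoid (a ⊔ c) (a ⊔ ℓ)
A ⇒ₛ S = ≡-setoid A (indexedSetoid S)

Mailbox : ℕ → Setoid 0ℓ 0ℓ
Mailbox p = Fin p ⇒ₛ List.setoid ℂ-setoid

remoteItems : ∀ {p} → Fin p → (Fin p → List ℂ) → ℕ
remoteItems {p} q mail =
  ListAction.sum (map (λ r → length (mail r)) (filter (λ r → ¬? (r ≟ q)) (allFin p)))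

-- traffic q r is the message from q to r.
HRelation : ∀ {p} → ℕ → (Fin p → Fin p → List ℂ) → Set
HRelation {p} h traffic = ∀ (q : Fin p) →
  remoteItems q (λ r → traffic q r) ℕ.≤ h × remoteItems q (λ r → traffic r q) ℕ.≤ h

-- A global redistribution round. Local computation between rounds is
-- absorbed into packing and unpacking. Messages are lists, so that their
-- sizes may depend on the data, and State is an arbitrary local memory.
record Round {p : ℕ} (State : Fin p → Setoid 0ℓ 0ℓ) : Set where
  field
    h      : ℕ
    pack   : ∀ q → State q ⟶ₛ Mailbox p
    unpack : ∀ q → (State q ×ₛ Mailbox p) ⟶ₛ State q

module _ {p : ℕ} {State : Fin p → Setoid 0ℓ 0ℓ} where

  open Round

  GlobalState : Set
  GlobalState = ∀ q → Setoid.Carrier (State q)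

  traffic : Round State → GlobalState → Fin p → Fin p → List ℂ
  traffic ρ s q = pack ρ q ⟨$⟩ s q

  step : Round State → GlobalState → GlobalState
  step ρ s r = unpack ρ r ⟨$⟩ (s r , λ q → traffic ρ s q r)

  run : List (Round State) → GlobalState → GlobalState
  run []      s = s
  run (ρ ∷ ρs) s = run ρs (step ρ s)

  -- The bound h of each round holds along the execution from s.
  HRelations : List (Round State) → GlobalState → Set
  HRelations []       s = ⊤
  HRelations (ρ ∷ ρs) s = HRelation (h ρ) (traffic ρ s) × HRelations ρs (step ρ s)

-- The input item j is initially stored on processor owner j and nowhere else:
-- the initial state of q is a function of the items owned by q.
record Algorithm {N p : ℕ} (owner : Fin N → Fin p) : Set₁ where

  Owned : Fin p → Set
  Owned q = ∃[ j ] owner j ≡ q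

  field
    State  : Fin p → Setoid 0ℓ 0ℓ
    load   : ∀ q → (Owned q ⇒ₛ ℂ-setoid) ⟶ₛ State q
    rounds : List (Round State)
    output : ∀ q → State q ⟶ₛ (Fin N ⇒ₛ Maybe.setoid ℂ-setoid)

  initial : (Fin N → ℂ) → GlobalState {State = State}
  initial x q = load q ⟨$⟩ λ (j , _) → x j

  field
    h-relations : ∀ x → HRelations rounds (initial x)

  final : (Fin N → ℂ) → GlobalState {State = State}
  final x = run rounds (initial x)

  -- Which processor returns which coefficient may depend on the input, and a
  -- coefficient may be returned by several processors.
  Returns : (Fin N → ℂ) → Fin p → Fin N → ℂ → Set
  Returns x q k v = (output q ⟨$⟩ final x q) k ≡ just v

  R : ℕ
  R = length rounds

CorrectDFT : ∀ {N p} {owner : Fin N → Fin p} → Algorithm owner → Set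
CorrectDFT A = ∀ x k →
  (∃₂ λ q v → Returns x q k v) × (∀ q v → Returns x q k v → v ≈ DFT x k)
  where open Algorithm A

-- Item j₁ N₂ + j₂ is owned by ⌊j₂ p / N₂⌋.
columnOwner : ∀ N₁ N₂ p .{{_ : NonZero N₂}} .{{_ : NonTrivial p}} → Fin (N₁ ℕ.* N₂) → Fin p
columnOwner N₁ N₂ p j = fromℕ< {toℕ j₂ ℕ.* p ℕ./ N₂} (m<n*o⇒m/o<n j₂p<pN₂)
  where
  j₂ : Fin N₂
  j₂ = remainder {N₁} N₂ j
  instance
    p≢0 : NonZero p
    p≢0 = ℕ.nonTrivial⇒nonZero p
  j₂p<pN₂ : toℕ j₂ ℕ.* p ℕ.< p ℕ.* N₂
  j₂p<pN₂ = subst (toℕ j₂ ℕ.* p ℕ.<_) (ℕₚ.*-comm N₂ p) (ℕₚ.*-monoˡ-< p (toℕ<n j₂))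

columnOwner-combine : ∀ N₁ N₂ p .{{_ : NonZero N₂}} .{{_ : NonTrivial p}} (j₁ : Fin N₁) (j₂ : Fin N₂) →
  toℕ (columnOwner N₁ N₂ p (combine j₁ j₂)) ≡ toℕ j₂ ℕ.* p ℕ./ N₂
columnOwner-combine N₁ N₂ p j₁ j₂ = trans (toℕ-fromℕ< _)
  (cong (λ j → toℕ (proj₂ j) ℕ.* p ℕ./ N₂) (remQuot-combine j₁ j₂))

-- No processor initially owns the entire input.
columnOwner-proper : ∀ N₁ N₂ p .{{_ : NonZero N₁}} .{{_ : NonZero N₂}} .{{_ : NonTrivial p}} →
  p ∣ N₂ → ∀ q → ∃[ j ] columnOwner N₁ N₂ p j ≢ q
columnOwner-proper N₁@(suc _) N₂@(suc n) p p∣N₂ q = choose (owner (combine top first) ≟ q)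
  where
  open ≡-Reasoning
  owner : Fin (N₁ ℕ.* N₂) → Fin p
  owner = columnOwner N₁ N₂ p
  top : Fin N₁
  top = zero
  first last : Fin N₂
  first = zero
  last  = fromℕ n
  1<p : 1 ℕ.< p
  1<p = ℕ.nonTrivial⇒n>1 p
  0<n : 1 ℕ.≤ n
  0<n = ℕ.s≤s⁻¹ (ℕₚ.≤-trans 1<p (∣⇒≤ p∣N₂))
  N₂≤np : N₂ ℕ.≤ n ℕ.* p
  N₂≤np = ℕₚ.≤-trans (ℕₚ.+-monoˡ-≤ n 0<n)
    (ℕₚ.≤-trans (ℕₚ.≤-reflexive (sym (trans (ℕₚ.*-comm n 2) (cong (n ℕ.+_) (ℕₚ.+-identityʳ n)))))
      (ℕₚ.*-monoʳ-≤ n 1<p))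
  0<last : 0 ℕ.< n ℕ.* p ℕ./ N₂
  0<last = m≥n⇒m/n>0 N₂≤np
  choose : Dec (owner (combine top first) ≡ q) → ∃[ j ] owner j ≢ q
  choose (no first≢q)  = combine top first , first≢q
  choose (yes first≡q) = combine top last , λ last≡q → ℕₚ.<⇒≢ 0<last (begin
    0                                ≡⟨ 0/n≡0 N₂ ⟨
    0 ℕ./ N₂                         ≡⟨ columnOwner-combine N₁ N₂ p top first ⟨
    toℕ (owner (combine top first))  ≡⟨ cong toℕ (trans first≡q (sym last≡q)) ⟩
    toℕ (owner (combine top last))   ≡⟨ columnOwner-combine N₁ N₂ p top last ⟩
    toℕ last ℕ.* p ℕ./ N₂            ≡⟨ cong (λ m → m ℕ.* p ℕ./ N₂) (toℕ-fromℕ n) ⟩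
    n ℕ.* p ℕ./ N₂                   ∎)

{-# OPTIONS --safe #-}
module Submission where

-- The zeroth DFT coefficient is the sum of all input items
-- (DFT-zero≈sum), so it depends on every one of them.  Without a
-- communication round, what a processor returns depends only on the items
-- that it owns (output-local).  Run the algorithm on the zero input: some
-- processor q returns the value 0 for coefficient 0.  Since q does not own
-- the entire input, there is an item j which q does not own.  Changing item j
-- from 0 to 1 is invisible to q, which therefore still returns 0, while the
-- correct value has become 1.
--
-- The processor returning a given coefficient may depend on the input, so q
-- has to be read off from the run on the zero input before j is chosen.

open import Defs
open import Data.Nat.Base using (ℕ; zero; suc; s≤s; z≤n; NonZero; NonTrivial; _≥_)
open import Data.Nat.Divisibility using (_∣_)
open import Algebra.Bundles using (CommutativeRing)
open import Data.Fin.Base using (Fin; zero; punchOut)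
open import Data.Fin.Properties using (punchIn-punchOut)
open import Data.Integer.Base using (+_)
open import Data.List.Base using (List; []; _∷_; length)
import Data.Maybe.Relation.Binary.Pointwise as Maybe
import Data.Nat.Properties as ℕₚ
open import Data.Product.Base using (∃-syntax; _×_; _,_; proj₂)
open import Data.Rational.Base as ℚ using (ℚ; 0ℚ; 1ℚ; ½)
import Data.Rational.Properties as ℚₚ
open import Data.Rational.Solver using (module +-*-Solver)
open import Data.Vec.Functional using (Vector; replicate; insertAt)
open import Data.Vec.Functional.Properties using (insertAt-lookup; insertAt-punchIn)
open import Function.Bundles using (Func; _⟨$⟩_)
open import Relation.Binary.Bundles using (Setoid)
open import Relation.Binary.PropositionalEquality as ≡ using (_≡_; _≢_)
open import Relation.Nullary.Decidable using (from-no)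
open import Relation.Nullary.Negation.Core using (¬_; contradiction)

open CommutativeRing ℂ-commutativeRing hiding (zero)
open import Algebra.Properties.CommutativeMonoid.Sum +-commutativeMonoid
  using (sum; sum-remove; sum-cong-≋; sum-replicate-zero)
open import Algebra.Properties.Ring ring using (-0#≈0#)

1≉0 : ¬ 1# ≈ 0#
1≉0 (re≃ Complex., _) with M , close ← re≃ ½ (ℚₚ.positive⁻¹ ½) =
  from-no (1ℚ ℚₚ.≤? ½) (close M M ℕₚ.≤-refl ℕₚ.≤-refl)

Σ<-head : ∀ (f : ℕ → ℚ) → (∀ k → f (suc k) ≡ 0ℚ) → ∀ n → Σ< f (suc n) ≡ f 0
Σ<-head f f≡0 zero    = ℚₚ.+-identityˡ (f 0)
Σ<-head f f≡0 (suc n) = ≡.trans (≡.cong₂ ℚ._+_ (Σ<-head f f≡0 n) (f≡0 n)) (ℚₚ.+-identityʳ (f 0))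

reTerm-zero : ∀ k → reTerm (suc k) 0ℚ 0ℚ ≡ 0ℚ
reTerm-zero k = solve 3 (λ c d i → (c :* con 0ℚ :- d :* con 0ℚ) :* i := con 0ℚ) ≡.refl
  (reTerm k 0ℚ 0ℚ) (imTerm k 0ℚ 0ℚ) (Rationals.1/1+ k)
  where open +-*-Solver

imTerm-zero : ∀ k → imTerm (suc k) 0ℚ 0ℚ ≡ 0ℚ
imTerm-zero k = solve 3 (λ c d i → (c :* con 0ℚ :+ d :* con 0ℚ) :* i := con 0ℚ) ≡.refl
  (reTerm k 0ℚ 0ℚ) (imTerm k 0ℚ 0ℚ) (Rationals.1/1+ k)
  where open +-*-Solver

-- A sequence that takes the value q from index 1 on represents q.  Index 0 is
-- exempt because there the partial sum of the exponential series is empty.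
eventually≡⇒~ : ∀ {s : Sequence} {q} → (∀ n → s (suc n) ≡ q) → s ~ (λ _ → q)
eventually≡⇒~ {s} {q} s≡q ε 0<ε = 1 , λ where
  (suc m) n _ _ → ℚₚ.≤-trans
    (ℚₚ.≤-reflexive (≡.cong ℚ.∣_∣
      (≡.trans (≡.cong (ℚ._- q) (s≡q m)) (ℚₚ.+-inverseʳ q))))
    (ℚₚ.<⇒≤ 0<ε)

exp-0# : Complex.exp 0# ≈ 1#
exp-0# =
  eventually≡⇒~ {λ n → Σ< (λ k → reTerm k 0ℚ 0ℚ) n} (Σ<-head (λ k → reTerm k 0ℚ 0ℚ) reTerm-zero) Complex.,
  eventually≡⇒~ {λ n → Σ< (λ k → imTerm k 0ℚ 0ℚ) n} (Σ<-head (λ k → imTerm k 0ℚ 0ℚ) imTerm-zero)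

Ω-zero : ∀ {n} (j : Fin (suc n)) → Ω zero j ≈ 1#
Ω-zero {n} j = trans (Complex.exp-cong exponent≈0) exp-0#
  where
  c : ℂ
  c = Complex.fromℝ (fromℚ (+ 2 ℚ./ 1)) * Complex.fromℝ π * Complex.ı
  exponent≈0 : - (c * Complex.fromℝ (fromℚ (+ 0 ℚ./ suc n))) ≈ 0#
  exponent≈0 = trans
    (-‿cong (trans
      (*-congˡ {c} (reflexive (≡.cong (λ q → Complex.fromℝ (fromℚ q)) (ℚₚ.0/n≡0 (suc n)))))
      (zeroʳ c)))
    -0#≈0#

DFT-zero≈sum : ∀ {n} (x : Fin (suc n) → ℂ) → DFT x zero ≈ sum x
DFT-zero≈sum x = sum-cong-≋ λ j →
  trans (*-congʳ {x j} (Ω-zero j)) (*-identityˡ (x j))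

zeros : ∀ n → Vector ℂ n
zeros n = replicate n 0#

-- The input that is 1 at j and 0 elsewhere.
unit : ∀ {n} → Fin (suc n) → Vector ℂ (suc n)
unit {n} j = insertAt (zeros n) j 1#

sum-unit : ∀ {n} (j : Fin (suc n)) → sum (unit j) ≈ 1#
sum-unit {n} j = trans (sum-remove {i = j} (unit j)) (trans
  (+-cong
    (reflexive (insertAt-lookup (zeros n) j 1#))
    (trans (sum-cong-≋ λ i → reflexive (insertAt-punchIn (zeros n) j 1# i)) (sum-replicate-zero n)))
  (+-identityʳ 1#))

unit-elsewhere : ∀ {n} (i j : Fin (suc n)) → j ≢ i → unit j i ≡ 0#
unit-elsewhere {n} i j j≢i = ≡.trans
  (≡.cong (unit j) (≡.sym (punchIn-punchOut j≢i)))
  (insertAt-punchIn (zeros n) j 1# (punchOut j≢i))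

DFT-zeros : ∀ n → DFT (zeros (suc n)) zero ≈ 0#
DFT-zeros n = trans (DFT-zero≈sum (zeros (suc n))) (sum-replicate-zero (suc n))

DFT-unit : ∀ {n} (j : Fin (suc n)) → DFT (unit j) zero ≈ 1#
DFT-unit j = trans (DFT-zero≈sum (unit j)) (sum-unit j)

module _ {N p} {owner : Fin N → Fin p} (A : Algorithm owner) where

  open Algorithm A

  -- Without rounds, two inputs that agree on the items owned by q lead q to
  -- the same output: q computes it from those items alone.
  output-local : rounds ≡ [] → ∀ {x y} q → (∀ j → owner j ≡ q → x j ≈ y j) →
    ∀ {k v} → Returns x q k v → ∃[ w ] Returns y q k w × v ≈ w
  output-local rounds≡[] {x} {y} q x≈y {k} x⇒v =
    Maybe.just-inv (≡.subst (λ m → Maybe.Pointwise _≈_ m ((output q ⟨$⟩ final y q) k)) x⇒v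
      (Func.cong (output q) finals≈ k))
    where
    module S = Setoid (State q)
    final≡initial : ∀ z → final z ≡ initial z
    final≡initial z = ≡.cong (λ ρs → run ρs (initial z)) rounds≡[]
    finals≈ : final x q S.≈ final y q
    finals≈ = ≡.subst₂ (λ s t → s q S.≈ t q)
      (≡.sym (final≡initial x)) (≡.sym (final≡initial y))
      (Func.cong (load q) λ (j , owned) → x≈y j owned)

-- The lower bound holds for every initial distribution in which no processor
-- owns the entire input.
correct⇒rounds≢[] : ∀ {n p} {owner : Fin (suc n) → Fin p} →
  (∀ q → ∃[ j ] owner j ≢ q) →
  (A : Algorithm owner) → CorrectDFT A → Algorithm.rounds A ≢ []
correct⇒rounds≢[] {n} proper A correct rounds≡[] =
  let (q , v , zeros⇒v) , zeros-sound = correct (zeros (suc n)) zero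
      j , j∉q = proper q
      w , unit⇒w , v≈w = output-local A rounds≡[] {zeros (suc n)} {unit j} q
        (λ i i∈q → reflexive (≡.sym (unit-elsewhere i j λ { ≡.refl → j∉q i∈q })))
        zeros⇒v
  in 1≉0 (begin
    1#                          ≈⟨ DFT-unit j ⟨
    DFT (unit j) zero           ≈⟨ proj₂ (correct (unit j) zero) q w unit⇒w ⟨
    w                           ≈⟨ v≈w ⟨
    v                           ≈⟨ zeros-sound q v zeros⇒v ⟩
    DFT (zeros (suc n)) zero    ≈⟨ DFT-zeros n ⟩
    0#                          ∎)
  where open import Relation.Binary.Reasoning.Setoid setoid

≢[]⇒length≥1 : ∀ {a} {A : Set a} {xs : List A} → xs ≢ [] → length xs ≥ 1
≢[]⇒length≥1 {xs = []}    xs≢[] = contradiction ≡.refl xs≢[]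
≢[]⇒length≥1 {xs = _ ∷ _} _     = s≤s z≤n

proposition3 : ∀ (N₁ N₂ p : ℕ) .{{_ : NonZero N₁}} .{{_ : NonZero N₂}} .{{_ : NonTrivial p}} →
    p ∣ N₁ → p ∣ N₂ →
    (A : Algorithm (columnOwner N₁ N₂ p)) → CorrectDFT A → Algorithm.R A ≥ 1
proposition3 N₁@(suc _) N₂@(suc _) p _ p∣N₂ A correct =
  ≢[]⇒length≥1 (correct⇒rounds≢[] (columnOwner-proper N₁ N₂ p p∣N₂) A correct)
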